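{- Let $\mathcal{T}$ be a finite tree, $w:V(\mathcal{T})\to\mathbb{R}_{\ge 0}$ a weight function, and $m=w(\mathcal{T})$. Then $$\mathtt{cent}(\mathcal{T},w)\le 2\cdot\mathtt{OPT}(\mathcal{T},w)-m.$$
   Context: For a subgraph $\mathcal{H}$ of $\mathcal{T}$, $w(\mathcal{H})=\sum_{x\in V(\mathcal{H})}w(x)$; for a subgraph $\mathcal{H}$, $w$ also denotes its restriction to $V(\mathcal{H})$. A search tree (STT) on a tree $\mathcal{T}$ is a rooted tree $T$ with vertex set $V(\mathcal{T})$ defined recursively: its root is an arbitrary vertex $r\in V(\mathcal{T})$, and the children of $r$ are the roots of search trees built on the connected components of $\mathcal{T}-r$ (one per component); a single-vertex tree has only itself as search tree. The cost of $T$ is $\mathtt{cost}_w(T)=\sum_{x}w(x)\cdot\mathtt{depth}_T(x)$, where the root has depth $1$. $\mathtt{OPT}(\mathcal{T},w)$ is the minimum cost over all search trees on $\mathcal{T}$. A vertex $v$ is a centroid of $(\mathcal{T},w)$ if every connected component $\mathcal{H}$ of $\mathcal{T}-v$ satisfies $w(\mathcal{H})\le w(\mathcal{T})/2$. A search tree $T$ is a centroid tree of $(\mathcal{T},w)$ if for every vertex $x$, $x$ is a centroid of $(\mathcal{T}[V(T_x)],w)$, where $T_x$ is the subtree of $T$ rooted at $x$. $\mathtt{cent}(\mathcal{T},w)$ is the maximum cost of a centroid tree of $(\mathcal{T},w)$. -}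

module Defs where

open import Data.Fin.Base using (Fin)
open import Data.Fin.Subset using (Subset; ⊤; ⁅_⁆; ⋃; _∈_; _-_)
open import Data.Fin.Subset.Properties using (_∈?_)
open import Data.Integer.Base using (+_)
open import Data.List.Base
  using (List; []; _∷_; _++_; _∷ʳ_; map; filter; foldr; length; allFin)
import Data.List.Membership.Propositional as List
open import Data.List.Relation.Binary.Pointwise.Base using (Pointwise)
open import Data.List.Relation.Unary.All using (All)
open import Data.List.Relation.Unary.Any using (Any)
open import Data.List.Relation.Unary.Linked using (Linked)
open import Data.List.Relation.Unary.Unique.Propositional using (Unique)
open import Data.Nat.Base as ℕ using (ℕ; suc)
import Data.Nat.Properties as ℕ
open import Data.Product.Base using (∃; _×_; _,_)
open import Data.Rational.Base as ℚ using (ℚ; 0ℚ; 1ℚ; ½; ∣_∣)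
import Data.Rational.Properties as ℚ
open import Data.Rational.Solver using (module +-*-Solver)
open import Function.Bundles using (_⇔_)
open import Relation.Binary.Construct.Closure.ReflexiveTransitive using (Star)
open import Relation.Binary.Definitions using (Decidable; Symmetric)
open import Relation.Binary.PropositionalEquality
  using (_≡_; refl; sym; trans; cong; subst)
open import Relation.Nullary.Negation using (¬_)

------------------------------------------------------------------------
-- Real numbers: Cauchy sequences of rationals, with pointwise operations.
-- The equality of reals is _≃_, not _≡_.

IsCauchy : (ℕ → ℚ) → Set
IsCauchy f = ∀ ε → 0ℚ ℚ.< ε →
  ∃ λ N → ∀ m n → N ℕ.≤ m → N ℕ.≤ n → ∣ f m ℚ.- f n ∣ ℚ.< ε

record ℝ : Set where
  constructor mkℝ
  field
    seq    : ℕ → ℚ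
    cauchy : IsCauchy seq

open ℝ public

infix 4 _≃_ _≤ℝ_

_≃_ : ℝ → ℝ → Set
x ≃ y = ∀ ε → 0ℚ ℚ.< ε →
  ∃ λ N → ∀ n → N ℕ.≤ n → ∣ seq x n ℚ.- seq y n ∣ ℚ.< ε

_≤ℝ_ : ℝ → ℝ → Set
x ≤ℝ y = ∀ ε → 0ℚ ℚ.< ε →
  ∃ λ N → ∀ n → N ℕ.≤ n → seq x n ℚ.< seq y n ℚ.+ ε

private
  half-pos : ∀ ε → 0ℚ ℚ.< ε → 0ℚ ℚ.< ½ ℚ.* ε
  half-pos ε 0<ε = subst (ℚ._< ½ ℚ.* ε) (ℚ.*-zeroʳ ½) (ℚ.*-monoʳ-<-pos ½ 0<ε)

  halves : ∀ ε → ½ ℚ.* ε ℚ.+ ½ ℚ.* ε ≡ ε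
  halves ε = trans (sym (ℚ.*-distribʳ-+ ε ½ ½)) (ℚ.*-identityˡ ε)

  interchange : ∀ a b c d →
    (a ℚ.+ b) ℚ.- (c ℚ.+ d) ≡ (a ℚ.- c) ℚ.+ (b ℚ.- d)
  interchange = solve 4 (λ a b c d →
    (a :+ b) :- (c :+ d) := (a :- c) :+ (b :- d)) refl
    where open +-*-Solver

  const-cauchy : ∀ q → IsCauchy (λ _ → q)
  const-cauchy q ε 0<ε = 0 , λ _ _ _ _ →
    subst (λ p → ∣ p ∣ ℚ.< ε) (sym (ℚ.+-inverseʳ q)) 0<ε

  +-cauchy : ∀ {f g} → IsCauchy f → IsCauchy g → IsCauchy (λ n → f n ℚ.+ g n)
  +-cauchy {f} {g} cf cg ε 0<ε
    with cf (½ ℚ.* ε) (half-pos ε 0<ε) | cg (½ ℚ.* ε) (half-pos ε 0<ε)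
  ... | M , hf | N , hg = M ℕ.+ N , λ m n p q → begin-strict
    ∣ (f m ℚ.+ g m) ℚ.- (f n ℚ.+ g n) ∣
      ≡⟨ cong ∣_∣ (interchange (f m) (g m) (f n) (g n)) ⟩
    ∣ (f m ℚ.- f n) ℚ.+ (g m ℚ.- g n) ∣
      ≤⟨ ℚ.∣p+q∣≤∣p∣+∣q∣ (f m ℚ.- f n) (g m ℚ.- g n) ⟩
    ∣ f m ℚ.- f n ∣ ℚ.+ ∣ g m ℚ.- g n ∣
      <⟨ ℚ.+-mono-< (hf m n (ℕ.m+n≤o⇒m≤o M p) (ℕ.m+n≤o⇒m≤o M q))
                    (hg m n (ℕ.m+n≤o⇒n≤o M p) (ℕ.m+n≤o⇒n≤o M q)) ⟩
    ½ ℚ.* ε ℚ.+ ½ ℚ.* ε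
      ≡⟨ halves ε ⟩
    ε ∎
    where open ℚ.≤-Reasoning

  *-cauchy : ∀ q {f} → IsCauchy f → IsCauchy (λ n → q ℚ.* f n)
  *-cauchy q {f} cf ε 0<ε = bound (cf (1/b ℚ.* ε) 0<δ)
    where
    open ℚ.≤-Reasoning

    b : ℚ
    b = ∣ q ∣ ℚ.+ 1ℚ

    ∣q∣<b : ∣ q ∣ ℚ.< b
    ∣q∣<b = subst (ℚ._< b) (ℚ.+-identityʳ ∣ q ∣)
      (ℚ.+-monoʳ-< ∣ q ∣ (ℚ.positive⁻¹ 1ℚ))

    instance
      b-pos : ℚ.Positive b
      b-pos = ℚ.positive (ℚ.≤-<-trans (ℚ.0≤∣p∣ q) ∣q∣<b)

      b-nonZero : ℚ.NonZero b
      b-nonZero = ℚ.pos⇒nonZero b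

    1/b : ℚ
    1/b = ℚ.1/ b

    0<δ : 0ℚ ℚ.< 1/b ℚ.* ε
    0<δ = subst (ℚ._< 1/b ℚ.* ε) (ℚ.*-zeroʳ 1/b)
      (ℚ.*-monoʳ-<-pos 1/b {{ℚ.1/pos⇒pos b}} 0<ε)

    factor : ∀ x y → q ℚ.* x ℚ.- q ℚ.* y ≡ q ℚ.* (x ℚ.- y)
    factor = solve 3 (λ q x y → q :* x :- q :* y := q :* (x :- y)) refl q
      where open +-*-Solver

    bound : (∃ λ N → ∀ m n → N ℕ.≤ m → N ℕ.≤ n →
               ∣ f m ℚ.- f n ∣ ℚ.< 1/b ℚ.* ε) →
            ∃ λ N → ∀ m n → N ℕ.≤ m → N ℕ.≤ n →
               ∣ q ℚ.* f m ℚ.- q ℚ.* f n ∣ ℚ.< ε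
    bound (N , h) = N , λ m n N≤m N≤n → let d = f m ℚ.- f n in begin-strict
      ∣ q ℚ.* f m ℚ.- q ℚ.* f n ∣  ≡⟨ cong ∣_∣ (factor (f m) (f n)) ⟩
      ∣ q ℚ.* d ∣                  ≡⟨ ℚ.∣p*q∣≡∣p∣*∣q∣ q d ⟩
      ∣ q ∣ ℚ.* ∣ d ∣              ≤⟨ ℚ.*-monoʳ-≤-nonNeg ∣ d ∣
                                        {{ℚ.∣-∣-nonNeg d}} (ℚ.<⇒≤ ∣q∣<b) ⟩
      b ℚ.* ∣ d ∣                  <⟨ ℚ.*-monoʳ-<-pos b (h m n N≤m N≤n) ⟩
      b ℚ.* (1/b ℚ.* ε)            ≡⟨ sym (ℚ.*-assoc b 1/b ε) ⟩
      (b ℚ.* 1/b) ℚ.* ε            ≡⟨ cong (ℚ._* ε) (ℚ.*-inverseʳ b) ⟩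
      1ℚ ℚ.* ε                     ≡⟨ ℚ.*-identityˡ ε ⟩
      ε                            ∎

infixl 6 _+ℝ_ _-ℝ_
infixl 7 _·_

0ℝ : ℝ
0ℝ = mkℝ (λ _ → 0ℚ) (const-cauchy 0ℚ)

_+ℝ_ : ℝ → ℝ → ℝ
x +ℝ y = mkℝ (λ n → seq x n ℚ.+ seq y n)
  (+-cauchy {seq x} {seq y} (cauchy x) (cauchy y))

-- Only products of a rational and a real are needed.
_·_ : ℚ → ℝ → ℝ
q · x = mkℝ (λ n → q ℚ.* seq x n) (*-cauchy q {seq x} (cauchy x))

_-ℝ_ : ℝ → ℝ → ℝ
x -ℝ y = x +ℝ (ℚ.- 1ℚ) · y

ℕ→ℚ : ℕ → ℚ
ℕ→ℚ n = + n ℚ./ 1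

sumℝ : List ℝ → ℝ
sumℝ = foldr _+ℝ_ 0ℝ

------------------------------------------------------------------------
-- Finite simple graphs and trees, with vertex set Fin n

record Graph (n : ℕ) : Set₁ where
  infix 4 _~_ _~?_
  field
    _~_      : Fin n → Fin n → Set
    _~?_     : Decidable _~_
    ~-sym    : Symmetric _~_
    ~-irrefl : ∀ {x} → ¬ (x ~ x)

module _ {n : ℕ} (G : Graph n) where
  open Graph G

  Connected : Set
  Connected = ∀ x y → Star _~_ x y

  -- The closed walk x , ys , x runs through the distinct vertices x ∷ ys.
  IsCycle : Fin n → List (Fin n) → Set
  IsCycle x ys =
    2 ℕ.≤ length ys × Unique (x ∷ ys) × Linked _~_ ((x ∷ ys) ∷ʳ x)

  record IsTree : Set where
    field
      nonempty  : ℕ.NonZero n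
      connected : Connected
      acyclic   : ∀ x ys → ¬ IsCycle x ys

  -- An edge of the induced subgraph G[S].
  Edge : Subset n → Fin n → Fin n → Set
  Edge S x y = x ∈ S × y ∈ S × x ~ y

  -- H is the vertex set of a connected component of G[S].
  IsComponent : Subset n → Subset n → Set
  IsComponent S H =
    ∃ λ x → x ∈ S × (∀ y → (y ∈ H) ⇔ Star (Edge S) x y)

  -- Hs lists all the components of G[S], each exactly once: a list of
  -- distinct components omits none of them iff its members cover S.
  record AreComponents (S : Subset n) (Hs : List (Subset n)) : Set where
    field
      components : All (IsComponent S) Hs
      distinct   : Unique Hs
      exhaustive : ∀ {x} → x ∈ S → Any (x ∈_) Hs

------------------------------------------------------------------------
-- Rooted trees. The order of the children is an artefact of the encoding;
-- nothing below depends on it.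

data RootedTree (n : ℕ) : Set where
  node : Fin n → List (RootedTree n) → RootedTree n

module _ {n : ℕ} where

  root : RootedTree n → Fin n
  root (node r _) = r

  mutual
    V : RootedTree n → Subset n
    V (node r ts) = ⋃ (⁅ r ⁆ ∷ Vs ts)

    Vs : List (RootedTree n) → List (Subset n)
    Vs []       = []
    Vs (t ∷ ts) = V t ∷ Vs ts

  -- U ⊑ T: U is the subtree of T rooted at one of the nodes of T.
  infix 4 _⊑_
  data _⊑_ (U : RootedTree n) : RootedTree n → Set where
    here  : U ⊑ U
    below : ∀ {r t ts} → U ⊑ t → t List.∈ ts → U ⊑ node r ts

  -- The nodes of a tree paired with their depths, if the root has depth d.
  mutual
    depths : ℕ → RootedTree n → List (Fin n × ℕ)
    depths d (node r ts) = (r , d) ∷ depthss (suc d) ts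

    depthss : ℕ → List (RootedTree n) → List (Fin n × ℕ)
    depthss d []       = []
    depthss d (t ∷ ts) = depths d t ++ depthss d ts

------------------------------------------------------------------------
-- Search trees

module _ {n : ℕ} (G : Graph n) where

  -- T is a search tree on G[S].
  data IsSearchTreeOn : Subset n → RootedTree n → Set where
    node : ∀ {S Hs r ts} → r ∈ S →
           AreComponents G (S - r) Hs →
           Pointwise IsSearchTreeOn Hs ts →
           IsSearchTreeOn S (node r ts)

  IsSearchTree : RootedTree n → Set
  IsSearchTree = IsSearchTreeOn ⊤

module _ {n : ℕ} (w : Fin n → ℝ) where

  weight : Subset n → ℝ
  weight S = sumℝ (map w (filter (_∈? S) (allFin n)))

  -- Each vertex occurs exactly once as a node of a search tree.
  cost : RootedTree n → ℝ
  cost T = sumℝ (map (λ (x , d) → ℕ→ℚ d · w x) (depths 1 T))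

module _ {n : ℕ} (G : Graph n) (w : Fin n → ℝ) where

  -- v is a centroid of G[S].
  IsCentroid : Subset n → Fin n → Set
  IsCentroid S v =
    v ∈ S × (∀ H → IsComponent G (S - v) H → weight w H ≤ℝ ½ · weight w S)

  IsCentroidTree : RootedTree n → Set
  IsCentroidTree T =
    IsSearchTree G T × (∀ {U} → U ⊑ T → IsCentroid (V U) (root U))

  IsOPT : ℝ → Set
  IsOPT opt = (∃ λ T → IsSearchTree G T × cost w T ≃ opt)
            × (∀ T → IsSearchTree G T → opt ≤ℝ cost w T)

  IsCent : ℝ → Set
  IsCent cent = (∃ λ T → IsCentroidTree T × cost w T ≃ cent)
              × (∀ T → IsCentroidTree T → cost w T ≤ℝ cent)

{-# OPTIONS --safe #-}
module Submission where

-- Fix a search tree T and let K S x be the number of ancestors of x in T that lie in S.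
-- By induction over a centroid tree C on a connected set S, cost C + w(S) ≤ 2 Σ_{x ∈ S} K S x · w x.
-- Let c be the root of C, H the components of S - c, and r the vertex of S that is an ancestor
-- in T of all of S. If r = c, then passing from S to the components costs every vertex of S
-- the ancestor c. Otherwise r lies in some component H₀, the vertices outside H₀ lose r and
-- c loses itself as well; this gains w(S) - w(H₀) + w(c) ≥ w(S)/2 + w(c).
-- The weights enter only through the preorder f ≼ g, meaning Σ f x · w x ≤ Σ g x · w x,
-- so that all the combinatorics consists of pointwise inequalities between natural numbers.

open import Defs
open import Data.Nat.Base using (ℕ)
open import Data.Fin.Base using (Fin)
open import Data.Fin.Subset using (⊤)

open import Data.Bool.Base using (if_then_else_)
open import Data.Fin.Base using (zero; suc)
import Data.Fin.Properties as Fin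
open import Data.Fin.Subset using (Subset; ⁅_⁆; ⋃; _∈_; _∉_; _⊆_; _-_)
open import Data.Fin.Subset.Properties
  using (_∈?_; ∉⊥; ∈⊤; x∈⁅x⁆; x∈⁅y⁆⇒x≡y; p─q⊆p; x∈p∧x≢y⇒x∈p-y; ⊆-antisym;
         x∈p∪q⁻; x∈p∪q⁺)
open import Data.List.Base using (List; []; _∷_; _++_; map; filter; tabulate)
open import Data.List.Properties using (filter-accept; filter-reject)
open import Data.List.Membership.Propositional using (find) renaming (_∈_ to _∈ₗ_)
open import Data.List.Relation.Binary.Pointwise.Base using (Pointwise; []; _∷_)
open import Data.List.Relation.Unary.All as All using (All; []; _∷_)
open import Data.List.Relation.Unary.Any using (Any; here; there)
open import Data.List.Relation.Unary.AllPairs using (_∷_)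
open import Data.List.Relation.Unary.Unique.Propositional using (Unique)
open import Data.Nat.Base using (zero; suc; _+_; _*_; _∸_; _≤_; z≤n)
open import Data.Nat.ListAction using (sum)
import Data.Nat.Properties as ℕ
open import Data.Nat.Solver using (module +-*-Solver)
open import Data.Product.Base using (∃; _×_; _,_; proj₂)
open import Data.Rational.Base as ℚ using (ℚ; 0ℚ; 1ℚ; ½; ∣_∣)
import Data.Rational.Properties as ℚ
import Data.Rational.Solver as ℚ
import Data.Rational.Unnormalised.Base as ℚᵘ
import Data.Rational.Unnormalised.Properties as ℚᵘ
import Data.Integer.Base as ℤ
import Data.Integer.Properties as ℤ
open import Data.Sum.Base using (inj₁; inj₂)
open import Data.Vec.Base using (_∷_; here; there)
open import Function.Base using (id; _∘_; const)
open import Function.Bundles using (module Equivalence)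
open import Relation.Binary.Construct.Closure.ReflexiveTransitive as Star
  using (Star; _◅_; _◅◅_)
open import Relation.Binary.PropositionalEquality
  using (_≡_; _≢_; refl; sym; trans; cong; cong₂; subst; module ≡-Reasoning)
open import Relation.Nullary.Decidable using (Dec; yes; no; does; dec-true; dec-false)
open import Relation.Nullary.Negation using (contradiction)

open import Algebra.Properties.CommutativeMonoid.Sum ℚ.+-0-commutativeMonoid as ∑ℚ
  using () renaming (sum to ∑)

-- Natural numbers as rationals

ℕ→ℚ-+ : ∀ m n → ℕ→ℚ (m + n) ≡ ℕ→ℚ m ℚ.+ ℕ→ℚ n
-- Normalisation of fractions blocks computation on both sides; over the unnormalised fractions with
-- denominator 1 only an identity of integers remains.
ℕ→ℚ-+ m n = ℚ.toℚᵘ-injective (begin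
  ℚ.toℚᵘ (ℕ→ℚ (m + n))                      ≈⟨ ℚ.toℚᵘ-fromℚᵘ (ι (m + n)) ⟩
  ι (m + n)                                 ≈⟨ ℚᵘ.*≡* (cong (ℤ._* ℤ.1ℤ)
                                                 (cong₂ ℤ._+_ (sym (ℤ.*-identityʳ (ℤ.+ m)))
                                                              (sym (ℤ.*-identityʳ (ℤ.+ n))))) ⟩
  ι m ℚᵘ.+ ι n                              ≈⟨ ℚᵘ.+-cong (ℚ.toℚᵘ-fromℚᵘ (ι m))
                                                         (ℚ.toℚᵘ-fromℚᵘ (ι n)) ⟨
  ℚ.toℚᵘ (ℕ→ℚ m) ℚᵘ.+ ℚ.toℚᵘ (ℕ→ℚ n)        ≈⟨ ℚ.toℚᵘ-homo-+ (ℕ→ℚ m) (ℕ→ℚ n) ⟨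
  ℚ.toℚᵘ (ℕ→ℚ m ℚ.+ ℕ→ℚ n)                  ∎)
  where
  open ℚᵘ.≃-Reasoning
  ι : ℕ → ℚᵘ.ℚᵘ
  ι k = ℚᵘ.mkℚᵘ (ℤ.+ k) 0

-- Rational sequences up to null sequences

infix 4 _≲_

-- The condition of `_≤ℝ_` on bare sequences, so that no Cauchy proofs are carried along; a record,
-- so that `a` and `b` can be inferred from a proof.
record _≲_ (a b : ℕ → ℚ) : Set where
  constructor eventually
  field
    bound : ∀ ε → 0ℚ ℚ.< ε → ∃ λ N → ∀ n → N ≤ n → a n ℚ.< b n ℚ.+ ε

open _≲_

+-mono-≲ : ∀ {a b c d} → a ≲ b → c ≲ d → (λ n → a n ℚ.+ c n) ≲ (λ n → b n ℚ.+ d n)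
+-mono-≲ {a} {b} {c} {d} a≲b c≲d .bound ε 0<ε =
  let M , p = a≲b .bound (½ ℚ.* ε) 0<½ε
      N , q = c≲d .bound (½ ℚ.* ε) 0<½ε
  in M + N , λ n M+N≤n → begin-strict
  a n ℚ.+ c n                              <⟨ ℚ.+-mono-< (p n (ℕ.m+n≤o⇒m≤o M M+N≤n))
                                                         (q n (ℕ.m+n≤o⇒n≤o M M+N≤n)) ⟩
  (b n ℚ.+ ½ ℚ.* ε) ℚ.+ (d n ℚ.+ ½ ℚ.* ε)  ≡⟨ split (b n) (d n) ε ⟩
  (b n ℚ.+ d n) ℚ.+ ε                      ∎
  where
  open ℚ.≤-Reasoning
  split : ∀ p q ε → (p ℚ.+ ½ ℚ.* ε) ℚ.+ (q ℚ.+ ½ ℚ.* ε) ≡ (p ℚ.+ q) ℚ.+ ε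
  split = solve 3 (λ p q ε → (p :+ con ½ :* ε) :+ (q :+ con ½ :* ε) := (p :+ q) :+ ε) refl
    where open ℚ.+-*-Solver
  0<½ε : 0ℚ ℚ.< ½ ℚ.* ε
  0<½ε = subst (ℚ._< ½ ℚ.* ε) (ℚ.*-zeroʳ ½) (ℚ.*-monoʳ-<-pos ½ 0<ε)

-- The pointwise equations let one lemma serve for rewriting (`s` zero), for cancelling (`s` a
-- negated sequence) and for splitting off a common summand.
shift-≲ : ∀ {a b c d} (s : ℕ → ℚ) → (∀ n → c n ≡ a n ℚ.+ s n) →
          (∀ n → d n ≡ b n ℚ.+ s n) → a ≲ b → c ≲ d
shift-≲ {a} {b} {c} {d} s c≡ d≡ a≲b .bound ε 0<ε =
  let N , p = a≲b .bound ε 0<ε in N , λ n N≤n → begin-strict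
  c n                    ≡⟨ c≡ n ⟩
  a n ℚ.+ s n            <⟨ ℚ.+-monoˡ-< (s n) (p n N≤n) ⟩
  (b n ℚ.+ ε) ℚ.+ s n    ≡⟨ swap (b n) (s n) ⟩
  (b n ℚ.+ s n) ℚ.+ ε    ≡⟨ cong (ℚ._+ ε) (d≡ n) ⟨
  d n ℚ.+ ε              ∎
  where
  open ℚ.≤-Reasoning
  swap : ∀ p q → (p ℚ.+ ε) ℚ.+ q ≡ (p ℚ.+ q) ℚ.+ ε
  swap p q = solve 3 (λ p q ε → (p :+ ε) :+ q := (p :+ q) :+ ε) refl p q ε
    where open ℚ.+-*-Solver

resp-≲ : ∀ {a b c d} → (∀ n → c n ≡ a n) → (∀ n → d n ≡ b n) → a ≲ b → c ≲ d
resp-≲ c≡a d≡b = shift-≲ (λ _ → 0ℚ)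
  (λ n → trans (c≡a n) (sym (ℚ.+-identityʳ _)))
  (λ n → trans (d≡b n) (sym (ℚ.+-identityʳ _)))

p≡p+q-q : ∀ p q → p ≡ (p ℚ.+ q) ℚ.+ ℚ.- q
p≡p+q-q = solve 2 (λ p q → p := (p :+ q) :+ :- q) refl
  where open ℚ.+-*-Solver

cancel-≲ : ∀ {a b} (s : ℕ → ℚ) → (λ n → a n ℚ.+ s n) ≲ (λ n → b n ℚ.+ s n) → a ≲ b
cancel-≲ {a} {b} s = shift-≲ (λ n → ℚ.- s n)
  (λ n → p≡p+q-q (a n) (s n)) (λ n → p≡p+q-q (b n) (s n))

-- Adding the two comparisons puts `b` on both sides, where it cancels.
≲-trans : ∀ {a b c} → a ≲ b → b ≲ c → a ≲ c
≲-trans {a} {b} {c} a≲b b≲c = cancel-≲ b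
  (resp-≲ (λ _ → refl) (λ n → ℚ.+-comm (c n) (b n)) (+-mono-≲ a≲b b≲c))

≲-refl : ∀ {a} → a ≲ a
≲-refl {a} .bound ε 0<ε = 0 , λ n _ →
  subst (ℚ._< a n ℚ.+ ε) (ℚ.+-identityʳ (a n)) (ℚ.+-monoʳ-< (a n) 0<ε)

p≤∣p∣ : ∀ p → p ℚ.≤ ∣ p ∣
p≤∣p∣ p with ℚ.≤-total 0ℚ p
... | inj₁ 0≤p = ℚ.≤-reflexive (sym (ℚ.0≤p⇒∣p∣≡p 0≤p))
... | inj₂ p≤0 = ℚ.≤-trans p≤0 (ℚ.0≤∣p∣ p)

≃⇒≲ : ∀ {x y} → x ≃ y → seq x ≲ seq y
≃⇒≲ {x} {y} x≃y .bound ε 0<ε =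
  let N , p = x≃y ε 0<ε in N , λ n N≤n → begin-strict
  seq x n                              ≡⟨ split (seq x n) (seq y n) ⟩
  seq y n ℚ.+ (seq x n ℚ.- seq y n)    ≤⟨ ℚ.+-monoʳ-≤ (seq y n) (p≤∣p∣ _) ⟩
  seq y n ℚ.+ ∣ seq x n ℚ.- seq y n ∣  <⟨ ℚ.+-monoʳ-< (seq y n) (p n N≤n) ⟩
  seq y n ℚ.+ ε                        ∎
  where
  open ℚ.≤-Reasoning
  split : ∀ p q → p ≡ q ℚ.+ (p ℚ.- q)
  split = solve 2 (λ p q → p := q :+ (p :- q)) refl
    where open ℚ.+-*-Solver

≃-sym : ∀ {x y} → x ≃ y → y ≃ x
≃-sym {x} {y} x≃y ε 0<ε with x≃y ε 0<ε
... | N , p = N , λ n N≤n → subst (ℚ._< ε)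
  (trans (sym (ℚ.∣-p∣≡∣p∣ _)) (cong ∣_∣ (flip (seq x n) (seq y n)))) (p n N≤n)
  where
  open ℚ.+-*-Solver
  flip : ∀ p q → ℚ.- (p ℚ.- q) ≡ q ℚ.- p
  flip = solve 2 (λ p q → :- (p :- q) := q :- p) refl

0≲∑ : ∀ {m} (v : Fin m → ℕ → ℚ) → (∀ i → (λ _ → 0ℚ) ≲ v i) →
      (λ _ → 0ℚ) ≲ (λ j → ∑ λ i → v i j)
0≲∑ {zero}  v 0≲v = ≲-refl
0≲∑ {suc m} v 0≲v = resp-≲ (λ _ → refl) (λ _ → refl)
  (+-mono-≲ (0≲v zero) (0≲∑ (v ∘ suc) (0≲v ∘ suc)))

ℕ→ℚ-suc-* : ∀ k q → ℕ→ℚ (suc k) ℚ.* q ≡ q ℚ.+ ℕ→ℚ k ℚ.* q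
ℕ→ℚ-suc-* k q = begin
  ℕ→ℚ (1 + k) ℚ.* q             ≡⟨ cong (ℚ._* q) (ℕ→ℚ-+ 1 k) ⟩
  (1ℚ ℚ.+ ℕ→ℚ k) ℚ.* q          ≡⟨ ℚ.*-distribʳ-+ q 1ℚ (ℕ→ℚ k) ⟩
  1ℚ ℚ.* q ℚ.+ ℕ→ℚ k ℚ.* q      ≡⟨ cong (ℚ._+ ℕ→ℚ k ℚ.* q) (ℚ.*-identityˡ q) ⟩
  q ℚ.+ ℕ→ℚ k ℚ.* q             ∎
  where open ≡-Reasoning

-- A product with `k` is a `k`-fold sum, so closure under addition suffices and `ε` need not be
-- rescaled.
0≲ℕ→ℚ* : ∀ k {a} → (λ _ → 0ℚ) ≲ a → (λ _ → 0ℚ) ≲ (λ j → ℕ→ℚ k ℚ.* a j)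
0≲ℕ→ℚ* zero    {a} 0≲a = resp-≲ (λ _ → refl) (λ j → ℚ.*-zeroˡ (a j)) ≲-refl
0≲ℕ→ℚ* (suc k) {a} 0≲a = resp-≲ (λ _ → refl) (λ j → ℕ→ℚ-suc-* k (a j))
  (+-mono-≲ 0≲a (0≲ℕ→ℚ* k 0≲a))

-- Indicator functions

x∉p-x : ∀ {n} (p : Subset n) x → x ∉ p - x
x∉p-x (_ ∷ p) (suc x) (there x∈p-x) = x∉p-x p x x∈p-x

𝟙 : ∀ {n} → Subset n → Fin n → ℕ
𝟙 S x = if does (x ∈? S) then 1 else 0

𝟙-∈ : ∀ {n} {S : Subset n} {x} → x ∈ S → 𝟙 S x ≡ 1
𝟙-∈ {S = S} {x} x∈S = cong (if_then 1 else 0) (dec-true (x ∈? S) x∈S)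

𝟙-∉ : ∀ {n} {S : Subset n} {x} → x ∉ S → 𝟙 S x ≡ 0
𝟙-∉ {S = S} {x} x∉S = cong (if_then 1 else 0) (dec-false (x ∈? S) x∉S)

𝟙-mono : ∀ {n} {S U : Subset n} → S ⊆ U → ∀ x → 𝟙 S x ≤ 𝟙 U x
𝟙-mono {S = S} S⊆U x with x ∈? S
... | yes x∈S = ℕ.≤-reflexive (sym (𝟙-∈ (S⊆U x∈S)))
... | no  _   = z≤n

𝟙-disjoint-+ : ∀ {n} {S U R : Subset n} → S ⊆ R → U ⊆ R → (∀ {x} → x ∈ S → x ∉ U) →
               ∀ x → 𝟙 S x + 𝟙 U x ≤ 𝟙 R x
𝟙-disjoint-+ {S = S} S⊆R U⊆R S#U x with x ∈? S
... | yes x∈S = ℕ.≤-reflexive (trans (cong suc (𝟙-∉ (S#U x∈S))) (sym (𝟙-∈ (S⊆R x∈S))))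
... | no  _   = 𝟙-mono U⊆R x

⁅⁆⊆ : ∀ {n} {S : Subset n} {y} → y ∈ S → ⁅ y ⁆ ⊆ S
⁅⁆⊆ {S = S} {y} y∈S x∈⁅y⁆ = subst (_∈ S) (sym (x∈⁅y⁆⇒x≡y y x∈⁅y⁆)) y∈S

𝟙-delete : ∀ {n} {S : Subset n} {y} → y ∈ S → ∀ x → 𝟙 ⁅ y ⁆ x + 𝟙 (S - y) x ≡ 𝟙 S x
𝟙-delete {S = S} {y} y∈S x with x Fin.≟ y
... | yes refl = trans (cong₂ _+_ (𝟙-∈ (x∈⁅x⁆ x)) (𝟙-∉ (x∉p-x S x))) (sym (𝟙-∈ y∈S))
... | no x≢y with x ∈? S
...   | yes x∈S = cong₂ _+_ (𝟙-∉ (x≢y ∘ x∈⁅y⁆⇒x≡y y)) (𝟙-∈ (x∈p∧x≢y⇒x∈p-y x∈S x≢y))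
...   | no  x∉S = cong₂ _+_ (𝟙-∉ (x≢y ∘ x∈⁅y⁆⇒x≡y y)) (𝟙-∉ (x∉S ∘ p─q⊆p S ⁅ y ⁆))

-- Weighted sums

module Weighted {n : ℕ} (w : Fin n → ℝ) where

  open ≡-Reasoning

  -- The `j`-th approximation of the real Σ f x · w x. Weights (`f = 𝟙 S`) and costs
  -- (`f = depth 1 T`) both have this form.
  L : (Fin n → ℕ) → ℕ → ℚ
  L f j = ∑ λ x → ℕ→ℚ (f x) ℚ.* seq (w x) j

  L-cong : ∀ {f g} → (∀ x → f x ≡ g x) → ∀ j → L f j ≡ L g j
  L-cong f≗g j = ∑ℚ.sum-cong-≗ λ x → cong (λ k → ℕ→ℚ k ℚ.* seq (w x) j) (f≗g x)

  L-+ : ∀ f g j → L (λ x → f x + g x) j ≡ L f j ℚ.+ L g j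
  L-+ f g j = trans
    (∑ℚ.sum-cong-≗ λ x → trans
      (cong (ℚ._* seq (w x) j) (ℕ→ℚ-+ (f x) (g x)))
      (ℚ.*-distribʳ-+ (seq (w x) j) (ℕ→ℚ (f x)) (ℕ→ℚ (g x))))
    (∑ℚ.∑-distrib-+ (λ x → ℕ→ℚ (f x) ℚ.* seq (w x) j) (λ x → ℕ→ℚ (g x) ℚ.* seq (w x) j))

  ∑-0 : ∀ {m} (k : Fin m → ℕ) (a : Fin m → ℚ) → (∀ i → k i ≡ 0) →
        ∑ (λ i → ℕ→ℚ (k i) ℚ.* a i) ≡ 0ℚ
  ∑-0 {m} k a k≡0 = trans
    (∑ℚ.sum-cong-≗ λ i → trans (cong (λ k → ℕ→ℚ k ℚ.* a i) (k≡0 i)) (ℚ.*-zeroˡ (a i)))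
    (∑ℚ.sum-replicate-zero m)

  -- Stated for arbitrary `m` and `a`, since the induction on `y` drops the first summand.
  ∑-single : ∀ {m} d (y : Fin m) (a : Fin m → ℚ) →
             ∑ (λ i → ℕ→ℚ (d * 𝟙 ⁅ y ⁆ i) ℚ.* a i) ≡ ℕ→ℚ d ℚ.* a y
  ∑-single d zero a = trans
    (cong₂ ℚ._+_ (cong (λ k → ℕ→ℚ k ℚ.* a zero) (ℕ.*-identityʳ d))
      (∑-0 (λ i → d * 𝟙 ⁅ zero ⁆ (suc i)) (a ∘ suc)
        -- `𝟙 ⁅ zero ⁆ (suc i)` reduces to the indicator of the empty set at `i`.
        λ i → trans (cong (d *_) (𝟙-∉ {x = i} ∉⊥)) (ℕ.*-zeroʳ d)))
    (ℚ.+-identityʳ _)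
  ∑-single d (suc y) a = trans
    (cong₂ ℚ._+_
      (trans (cong (λ k → ℕ→ℚ k ℚ.* a zero) (ℕ.*-zeroʳ d)) (ℚ.*-zeroˡ (a zero)))
      (∑-single d y (a ∘ suc)))
    (ℚ.+-identityˡ _)

  L-single : ∀ d y j → L (λ x → d * 𝟙 ⁅ y ⁆ x) j ≡ ℕ→ℚ d ℚ.* seq (w y) j
  L-single d y j = ∑-single d y (λ x → seq (w x) j)

  seq-weight : ∀ S j → seq (weight w S) j ≡ L (𝟙 S) j
  seq-weight S j = filtered id
    where
    -- `allFin n` is `tabulate id`, whose tail is no longer of that form; a general `h` makes the
    -- induction go through.
    filtered : ∀ {m} (h : Fin m → Fin n) →
      seq (sumℝ (map w (filter (_∈? S) (tabulate h)))) j
      ≡ ∑ (λ i → ℕ→ℚ (𝟙 S (h i)) ℚ.* seq (w (h i)) j)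
    filtered {zero}  h = refl
    filtered {suc m} h = head (h zero ∈? S)
      where
      rest : List (Fin n)
      rest = tabulate (h ∘ suc)

      Σrest : ℚ
      Σrest = ∑ λ i → ℕ→ℚ (𝟙 S (h (suc i))) ℚ.* seq (w (h (suc i))) j

      w₀ : ℚ
      w₀ = seq (w (h zero)) j

      head : Dec (h zero ∈ S) →
        seq (sumℝ (map w (filter (_∈? S) (h zero ∷ rest)))) j
        ≡ ℕ→ℚ (𝟙 S (h zero)) ℚ.* w₀ ℚ.+ Σrest
      head (yes h0∈S) = begin
        seq (sumℝ (map w (filter (_∈? S) (h zero ∷ rest)))) j
          ≡⟨ cong (λ xs → seq (sumℝ (map w xs)) j) (filter-accept (_∈? S) h0∈S) ⟩
        w₀ ℚ.+ seq (sumℝ (map w (filter (_∈? S) rest))) j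
          ≡⟨ cong₂ ℚ._+_ (sym (ℚ.*-identityˡ w₀)) (filtered (h ∘ suc)) ⟩
        1ℚ ℚ.* w₀ ℚ.+ Σrest
          ≡⟨ cong (λ k → ℕ→ℚ k ℚ.* w₀ ℚ.+ Σrest) (𝟙-∈ h0∈S) ⟨
        ℕ→ℚ (𝟙 S (h zero)) ℚ.* w₀ ℚ.+ Σrest ∎
      head (no h0∉S) = begin
        seq (sumℝ (map w (filter (_∈? S) (h zero ∷ rest)))) j
          ≡⟨ cong (λ xs → seq (sumℝ (map w xs)) j) (filter-reject (_∈? S) h0∉S) ⟩
        seq (sumℝ (map w (filter (_∈? S) rest))) j
          ≡⟨ trans (filtered (h ∘ suc)) (sym (ℚ.+-identityˡ Σrest)) ⟩
        0ℚ ℚ.+ Σrest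
          ≡⟨ cong (ℚ._+ Σrest) (ℚ.*-zeroˡ w₀) ⟨
        0ℚ ℚ.* w₀ ℚ.+ Σrest
          ≡⟨ cong (λ k → ℕ→ℚ k ℚ.* w₀ ℚ.+ Σrest) (𝟙-∉ h0∉S) ⟨
        ℕ→ℚ (𝟙 S (h zero)) ℚ.* w₀ ℚ.+ Σrest ∎

  infix 4 _≼_

  -- Wrapped in a record because `f` and `g` cannot be recovered from the sequences `L f` and `L g`.
  record _≼_ (f g : Fin n → ℕ) : Set where
    constructor weighted
    field
      sums : L f ≲ L g

  open _≼_ public

  ≼-refl : ∀ f → f ≼ f
  ≼-refl f .sums = ≲-refl

  ≼-trans : ∀ {f g h} → f ≼ g → g ≼ h → f ≼ h
  ≼-trans f≼g g≼h .sums = ≲-trans (f≼g .sums) (g≼h .sums)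

  +-mono-≼ : ∀ {f g h k} → f ≼ g → h ≼ k → (λ x → f x + h x) ≼ (λ x → g x + k x)
  +-mono-≼ {f} {g} {h} {k} f≼g h≼k .sums =
    resp-≲ (L-+ f h) (L-+ g k) (+-mono-≲ (f≼g .sums) (h≼k .sums))

  cancel-≼ : ∀ {f g} h → (λ x → f x + h x) ≼ (λ x → g x + h x) → f ≼ g
  cancel-≼ {f} {g} h f+h≼g+h .sums = cancel-≲ (L h)
    (resp-≲ (sym ∘ L-+ f h) (sym ∘ L-+ g h) (f+h≼g+h .sums))

  module _ (0≤w : ∀ x → 0ℝ ≤ℝ w x) where

    -- `L g` is `L f` plus a sum with the natural coefficients `g x ∸ f x`, which is nonnegative up
    -- to `ε`. This is where the nonnegativity of the weights enters.
    ≤⇒≼ : ∀ {f g} → (∀ x → f x ≤ g x) → f ≼ g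
    ≤⇒≼ {f} {g} f≤g .sums = shift-≲ (L f)
      (λ j → sym (ℚ.+-identityˡ (L f j)))
      (λ j → trans (L-cong (λ x → sym (ℕ.m∸n+n≡m (f≤g x))) j) (L-+ (λ x → g x ∸ f x) f j))
      (0≲∑ _ λ x → 0≲ℕ→ℚ* (g x ∸ f x) (eventually (0≤w x)))

-- Depths and ancestors in rooted trees

interchange : ∀ a b c d → (a + b) + (c + d) ≡ (a + c) + (b + d)
interchange = solve 4 (λ a b c d → (a :+ b) :+ (c :+ d) := (a :+ c) :+ (b :+ d)) refl
  where open +-*-Solver

module _ {n : ℕ} where

  mutual
    -- A rooted tree may repeat labels. Counting nodes with multiplicity keeps the identities of
    -- this part valid for all rooted trees; in a search tree on `S` the count is `𝟙 S`.
    multiplicity : RootedTree n → Fin n → ℕ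
    multiplicity (node r ts) x = 𝟙 ⁅ r ⁆ x + multiplicities ts x

    multiplicities : List (RootedTree n) → Fin n → ℕ
    multiplicities []       x = 0
    multiplicities (t ∷ ts) x = multiplicity t x + multiplicities ts x

  -- The depth of x if the root has depth d, summed over the nodes labelled x.
  mutual
    depth : ℕ → RootedTree n → Fin n → ℕ
    depth d (node r ts) x = d * 𝟙 ⁅ r ⁆ x + depthᶠ (suc d) ts x

    depthᶠ : ℕ → List (RootedTree n) → Fin n → ℕ
    depthᶠ d []       x = 0
    depthᶠ d (t ∷ ts) x = depth d t x + depthᶠ d ts x

  -- The sum of f over the ancestors of x, including x itself.
  mutual
    ancestors : (Fin n → ℕ) → RootedTree n → Fin n → ℕ
    ancestors f (node r ts) x = f r * multiplicity (node r ts) x + ancestorsᶠ f ts x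

    ancestorsᶠ : (Fin n → ℕ) → List (RootedTree n) → Fin n → ℕ
    ancestorsᶠ f []       x = 0
    ancestorsᶠ f (t ∷ ts) x = ancestors f t x + ancestorsᶠ f ts x

  mutual
    -- For a search tree and `d = 1`, this merges cost plus weight into the single function
    -- `depth 2`.
    depth-suc : ∀ d t x → depth (suc d) t x ≡ depth d t x + multiplicity t x
    depth-suc d (node r ts) x = trans
      (cong (suc d * 𝟙 ⁅ r ⁆ x +_) (depthᶠ-suc (suc d) ts x))
      (solve 4 (λ d i D N → (i :+ d :* i) :+ (D :+ N) := (d :* i :+ D) :+ (i :+ N)) refl
        d (𝟙 ⁅ r ⁆ x) (depthᶠ (suc d) ts x) (multiplicities ts x))
      where open +-*-Solver

    depthᶠ-suc : ∀ d ts x → depthᶠ (suc d) ts x ≡ depthᶠ d ts x + multiplicities ts x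
    depthᶠ-suc d []       x = refl
    depthᶠ-suc d (t ∷ ts) x = trans
      (cong₂ _+_ (depth-suc d t x) (depthᶠ-suc d ts x))
      (interchange (depth d t x) _ _ _)

  mutual
    -- Two ways to count the path from the root: `ancestors` adds 1 to a whole subtree at its root,
    -- which is the shift by one level in `depthᶠ-suc`.
    ancestors-1 : ∀ t x → ancestors (const 1) t x ≡ depth 1 t x
    ancestors-1 (node r ts) x = trans
      (cong (1 * multiplicity (node r ts) x +_) (ancestorsᶠ-1 ts x))
      (trans
        (solve 3 (λ i N D → con 1 :* (i :+ N) :+ D := con 1 :* i :+ (D :+ N)) refl
          (𝟙 ⁅ r ⁆ x) (multiplicities ts x) (depthᶠ 1 ts x))
        (cong (1 * 𝟙 ⁅ r ⁆ x +_) (sym (depthᶠ-suc 1 ts x))))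
      where open +-*-Solver

    ancestorsᶠ-1 : ∀ ts x → ancestorsᶠ (const 1) ts x ≡ depthᶠ 1 ts x
    ancestorsᶠ-1 []       x = refl
    ancestorsᶠ-1 (t ∷ ts) x = cong₂ _+_ (ancestors-1 t x) (ancestorsᶠ-1 ts x)

  mutual
    ancestors-mono : ∀ {f g} → (∀ x → f x ≤ g x) → ∀ t x → ancestors f t x ≤ ancestors g t x
    ancestors-mono f≤g (node r ts) x = ℕ.+-mono-≤
      (ℕ.*-monoˡ-≤ (multiplicity (node r ts) x) (f≤g r)) (ancestorsᶠ-mono f≤g ts x)

    ancestorsᶠ-mono : ∀ {f g} → (∀ x → f x ≤ g x) →
                      ∀ ts x → ancestorsᶠ f ts x ≤ ancestorsᶠ g ts x
    ancestorsᶠ-mono f≤g []       x = z≤n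
    ancestorsᶠ-mono f≤g (t ∷ ts) x = ℕ.+-mono-≤ (ancestors-mono f≤g t x) (ancestorsᶠ-mono f≤g ts x)

  mutual
    ancestors-+ : ∀ f g t x →
      ancestors (λ y → f y + g y) t x ≡ ancestors f t x + ancestors g t x
    ancestors-+ f g (node r ts) x = trans
      (cong₂ _+_ (ℕ.*-distribʳ-+ (multiplicity (node r ts) x) (f r) (g r)) (ancestorsᶠ-+ f g ts x))
      (interchange (f r * multiplicity (node r ts) x) _ _ _)

    ancestorsᶠ-+ : ∀ f g ts x →
      ancestorsᶠ (λ y → f y + g y) ts x ≡ ancestorsᶠ f ts x + ancestorsᶠ g ts x
    ancestorsᶠ-+ f g []       x = refl
    ancestorsᶠ-+ f g (t ∷ ts) x = trans
      (cong₂ _+_ (ancestors-+ f g t x) (ancestorsᶠ-+ f g ts x))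
      (interchange (ancestors f t x) _ _ _)

  mutual
    -- Every node counts among its own ancestors.
    multiplicity≤ancestors : ∀ t x → multiplicity t x ≤ ancestors (𝟙 ⁅ x ⁆) t x
    multiplicity≤ancestors (node r ts) x with r Fin.≟ x
    ... | yes refl = ℕ.≤-trans
      (ℕ.≤-reflexive (sym (trans
        (cong (_* multiplicity (node r ts) x) (𝟙-∈ (x∈⁅x⁆ r))) (ℕ.*-identityˡ _))))
      (ℕ.m≤m+n _ _)
    ... | no r≢x = ℕ.≤-trans
      (ℕ.≤-reflexive (cong (_+ multiplicities ts x) (𝟙-∉ (r≢x ∘ sym ∘ x∈⁅y⁆⇒x≡y r))))
      (ℕ.≤-trans (multiplicities≤ancestorsᶠ ts x) (ℕ.m≤n+m _ _))

    multiplicities≤ancestorsᶠ : ∀ ts x → multiplicities ts x ≤ ancestorsᶠ (𝟙 ⁅ x ⁆) ts x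
    multiplicities≤ancestorsᶠ []       x = z≤n
    multiplicities≤ancestorsᶠ (t ∷ ts) x =
      ℕ.+-mono-≤ (multiplicity≤ancestors t x) (multiplicities≤ancestorsᶠ ts x)

  seq-cost : ∀ (w : Fin n → ℝ) T j → seq (cost w T) j ≡ Weighted.L w (depth 1 T) j
  seq-cost w T j = total-depths 1 T
    where
    open Weighted w
    open ≡-Reasoning

    total : List (Fin n × ℕ) → ℚ
    total ps = seq (sumℝ (map (λ (x , d) → ℕ→ℚ d · w x) ps)) j

    total-++ : ∀ ps qs → total (ps ++ qs) ≡ total ps ℚ.+ total qs
    total-++ []       qs = sym (ℚ.+-identityˡ _)
    total-++ ((x , d) ∷ ps) qs = trans
      (cong (ℕ→ℚ d ℚ.* seq (w x) j ℚ.+_) (total-++ ps qs))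
      (sym (ℚ.+-assoc (ℕ→ℚ d ℚ.* seq (w x) j) (total ps) (total qs)))

    mutual
      total-depths : ∀ d t → total (depths d t) ≡ L (depth d t) j
      total-depths d (node r ts) = trans
        (cong₂ ℚ._+_ (sym (L-single d r j)) (total-depthss (suc d) ts))
        (sym (L-+ (λ x → d * 𝟙 ⁅ r ⁆ x) (depthᶠ (suc d) ts) j))

      total-depthss : ∀ d ts → total (depthss d ts) ≡ L (depthᶠ d ts) j
      total-depthss d []       = sym (∑-0 (const 0) (λ x → seq (w x) j) (λ _ → refl))
      total-depthss d (t ∷ ts) = begin
        total (depths d t ++ depthss d ts)              ≡⟨ total-++ (depths d t) (depthss d ts) ⟩
        total (depths d t) ℚ.+ total (depthss d ts)     ≡⟨ cong₂ ℚ._+_ (total-depths d t) (total-depthss d ts) ⟩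
        L (depth d t) j ℚ.+ L (depthᶠ d ts) j           ≡⟨ L-+ (depth d t) (depthᶠ d ts) j ⟨
        L (depthᶠ d (t ∷ ts)) j                         ∎

-- Components and search trees

module _ {A : Set} {g : A → ℕ} where

  sum-map-0 : ∀ {xs} → All (λ x → g x ≡ 0) xs → sum (map g xs) ≡ 0
  sum-map-0 []           = refl
  sum-map-0 (gx≡0 ∷ gxs) = cong₂ _+_ gx≡0 (sum-map-0 gxs)

  sum-map-single : ∀ {y xs} → Unique xs → y ∈ₗ xs → All (λ x → y ≢ x → g x ≡ 0) xs →
                   sum (map g xs) ≡ g y
  sum-map-single (y∉xs ∷ _) (here refl) (_ ∷ h) = trans
    (cong (g _ +_) (sum-map-0 (All.zipWith (λ (y≢x , gx≡0) → gx≡0 y≢x) (y∉xs , h))))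
    (ℕ.+-identityʳ _)
  sum-map-single (x∉xs ∷ u) (there y∈xs) (gx≡0 ∷ h) = cong₂ _+_
    (gx≡0 λ y≡x → All.lookup x∉xs y∈xs (sym y≡x))
    (sum-map-single u y∈xs h)

∈⋃⁺ : ∀ {n} {x : Fin n} Hs → Any (x ∈_) Hs → x ∈ ⋃ Hs
∈⋃⁺ (_ ∷ _)  (here x∈H)   = x∈p∪q⁺ (inj₁ x∈H)
∈⋃⁺ (_ ∷ Hs) (there x∈Hs) = x∈p∪q⁺ (inj₂ (∈⋃⁺ Hs x∈Hs))

∈⋃⁻ : ∀ {n} {x : Fin n} Hs → x ∈ ⋃ Hs → Any (x ∈_) Hs
∈⋃⁻ []       x∈⊥ = contradiction x∈⊥ ∉⊥
∈⋃⁻ (H ∷ Hs) x∈  with x∈p∪q⁻ H (⋃ Hs) x∈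
... | inj₁ x∈H  = here x∈H
... | inj₂ x∈Hs = there (∈⋃⁻ Hs x∈Hs)

module _ {n : ℕ} (G : Graph n) where

  private variable
    S S′ H H′ : Subset n
    Hs : List (Subset n)
    ts : List (RootedTree n)
    t : RootedTree n
    x y : Fin n

  Path : Subset n → Fin n → Fin n → Set
  Path S = Star (Edge G S)

  Path-sym : Path S x y → Path S y x
  Path-sym = Star.reverse λ (x∈S , y∈S , x~y) → y∈S , x∈S , Graph.~-sym G x~y

  Path-mono : S ⊆ S′ → Path S x y → Path S′ x y
  Path-mono S⊆S′ = Star.map λ (x∈S , y∈S , x~y) → S⊆S′ x∈S , S⊆S′ y∈S , x~y

  Path-∈ : x ∈ S → Path S x y → y ∈ S
  Path-∈ x∈S Star.ε                = x∈S
  Path-∈ x∈S ((_ , y∈S , _) ◅ p) = Path-∈ y∈S p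

  -- Includes nonemptiness: the base point is what selects a component in `common-ancestor`.
  RootedConnected : Subset n → Set
  RootedConnected S = ∃ λ x → x ∈ S × (∀ {y} → y ∈ S → Path S x y)

  component-⊆ : IsComponent G S H → H ⊆ S
  component-⊆ (_ , x∈S , reach) y∈H = Path-∈ x∈S (Equivalence.to (reach _) y∈H)

  component-closed : IsComponent G S H → x ∈ H → Path S x y → y ∈ H
  component-closed (_ , _ , reach) x∈H p =
    Equivalence.from (reach _) (Equivalence.to (reach _) x∈H ◅◅ p)

  component-unique : IsComponent G S H → IsComponent G S H′ → x ∈ H → x ∈ H′ → H ≡ H′
  component-unique c c′ x∈H x∈H′ = ⊆-antisym (included c c′ x∈H x∈H′) (included c′ c x∈H′ x∈H)
    where
    included : ∀ {H H′ x} → IsComponent G S H → IsComponent G S H′ →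
               x ∈ H → x ∈ H′ → H ⊆ H′
    included (_ , _ , reach) c′ x∈H x∈H′ y∈H = component-closed c′ x∈H′
      (Path-sym (Equivalence.to (reach _) x∈H) ◅◅ Equivalence.to (reach _) y∈H)

  -- A path in `G[S]` that starts in a component never leaves it, so its edges already belong to
  -- `G[H]`.
  component-connected : IsComponent G S H → RootedConnected H
  component-connected {S = S} {H} c@(x , x∈S , reach) =
    x , x∈H , λ y∈H → restrict x∈H (Equivalence.to (reach _) y∈H)
    where
    x∈H : x ∈ H
    x∈H = Equivalence.from (reach x) Star.ε

    restrict : ∀ {y z} → y ∈ H → Path S y z → Path H y z
    restrict y∈H Star.ε    = Star.ε
    restrict y∈H (e@(_ , _ , y~z) ◅ p) = (y∈H , z∈H , y~z) ◅ restrict z∈H p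
      where z∈H = component-closed c y∈H (e ◅ Star.ε)

  module _ (comps : AreComponents G S Hs) where

    open AreComponents comps

    component-of : x ∈ S → ∃ λ H → H ∈ₗ Hs × x ∈ H
    component-of x∈S = find (exhaustive x∈S)

    sum-components-∉ : (g : Subset n → ℕ) → (∀ {H} → x ∉ H → g H ≡ 0) →
                       x ∉ S → sum (map g Hs) ≡ 0
    sum-components-∉ g g≡0 x∉S =
      sum-map-0 (All.map (λ c → g≡0 (x∉S ∘ component-⊆ c)) components)

    -- Components that share `x` are equal, and `Hs` has no repetitions, so `H` alone contributes.
    sum-components-∈ : (g : Subset n → ℕ) → (∀ {H} → x ∉ H → g H ≡ 0) →
                       H ∈ₗ Hs → x ∈ H → sum (map g Hs) ≡ g H
    sum-components-∈ g g≡0 H∈Hs x∈H = sum-map-single distinct H∈Hs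
      (All.map (λ c H≢H′ → g≡0 λ x∈H′ →
         H≢H′ (component-unique (All.lookup components H∈Hs) c x∈H x∈H′)) components)

  mutual
    -- The centroid condition speaks of `V U`, the induction of the sets in `IsSearchTreeOn`; this
    -- identifies the two.
    V≡ : IsSearchTreeOn G S t → V t ≡ S
    V≡ {S = S} (node {Hs = Hs} {r} r∈S comps trees) = trans
      (cong (λ Us → ⋃ (⁅ r ⁆ ∷ Us)) (Vs≡ trees))
      (⊆-antisym to from)
      where
      open AreComponents comps

      to : ⋃ (⁅ r ⁆ ∷ Hs) ⊆ S
      to x∈ with ∈⋃⁻ (⁅ r ⁆ ∷ Hs) x∈
      ... | here x∈⁅r⁆ = ⁅⁆⊆ r∈S x∈⁅r⁆
      ... | there x∈Hs with find x∈Hs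
      ...   | _ , H∈Hs , x∈H = p─q⊆p S ⁅ r ⁆ (component-⊆ (All.lookup components H∈Hs) x∈H)

      from : S ⊆ ⋃ (⁅ r ⁆ ∷ Hs)
      from {x} x∈S with x Fin.≟ r
      ... | yes refl = ∈⋃⁺ (⁅ r ⁆ ∷ Hs) (here (x∈⁅x⁆ x))
      ... | no  x≢r  = ∈⋃⁺ (⁅ r ⁆ ∷ Hs) (there (exhaustive (x∈p∧x≢y⇒x∈p-y x∈S x≢r)))

    Vs≡ : Pointwise (IsSearchTreeOn G) Hs ts → Vs ts ≡ Hs
    Vs≡ []             = refl
    Vs≡ (tree ∷ trees) = cong₂ _∷_ (V≡ tree) (Vs≡ trees)

  sum-𝟙-components : AreComponents G S Hs → ∀ x → sum (map (λ H → 𝟙 H x) Hs) ≡ 𝟙 S x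
  sum-𝟙-components {S = S} comps x with x ∈? S
  ... | no  x∉S = sum-components-∉ comps (λ H → 𝟙 H x) 𝟙-∉ x∉S
  ... | yes x∈S with component-of comps x∈S
  ...   | H , H∈Hs , x∈H =
    trans (sum-components-∈ comps (λ H → 𝟙 H x) 𝟙-∉ H∈Hs x∈H) (𝟙-∈ x∈H)

  mutual
    multiplicity≡𝟙 : IsSearchTreeOn G S t → ∀ x → multiplicity t x ≡ 𝟙 S x
    multiplicity≡𝟙 (node {r = r} r∈S comps trees) x = trans
      (cong (𝟙 ⁅ r ⁆ x +_) (trans (multiplicities≡sum trees x) (sum-𝟙-components comps x)))
      (𝟙-delete r∈S x)

    multiplicities≡sum : Pointwise (IsSearchTreeOn G) Hs ts →
                         ∀ x → multiplicities ts x ≡ sum (map (λ H → 𝟙 H x) Hs)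
    multiplicities≡sum []             x = refl
    multiplicities≡sum (tree ∷ trees) x =
      cong₂ _+_ (multiplicity≡𝟙 tree x) (multiplicities≡sum trees x)

  mutual
    -- Descend from the root. As long as the root `r` avoids `S′`, connectedness keeps `S′` inside
    -- one component of `S - r`, hence inside one child. The first root that lies in `S′` is above
    -- all of `S′`.
    common-ancestor : IsSearchTreeOn G S t → S′ ⊆ S → RootedConnected S′ →
      ∃ λ r → r ∈ S′ × (∀ {x} → x ∈ S′ → 1 ≤ ancestors (𝟙 ⁅ r ⁆) t x)
    common-ancestor {S = S} {S′ = S′} tree@(node {Hs = Hs} {r} {ts} r∈S comps trees) S′⊆S
      conn@(x₀ , x₀∈S′ , reach) with r ∈? S′
    ... | yes r∈S′ = r , r∈S′ , λ {x} x∈S′ → ℕ.m≤n⇒m≤n+o (ancestorsᶠ (𝟙 ⁅ r ⁆) ts x)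
      (ℕ.≤-reflexive (sym (cong₂ _*_
        (𝟙-∈ (x∈⁅x⁆ r))
        (trans (multiplicity≡𝟙 tree x) (𝟙-∈ (S′⊆S x∈S′))))))
    ... | no r∉S′ = inComponent (component-of comps (S′⊆S-r x₀∈S′))
      where
      S′⊆S-r : S′ ⊆ S - r
      S′⊆S-r {x} x∈S′ = x∈p∧x≢y⇒x∈p-y (S′⊆S x∈S′) λ x≡r → r∉S′ (subst (_∈ S′) x≡r x∈S′)

      inComponent : (∃ λ H → H ∈ₗ Hs × x₀ ∈ H) →
        ∃ λ r′ → r′ ∈ S′ × (∀ {x} → x ∈ S′ → 1 ≤ ancestors (𝟙 ⁅ r′ ⁆) (node r ts) x)
      inComponent (H , H∈Hs , x₀∈H) =
        let r′ , r′∈S′ , above = common-ancestorᶠ trees H∈Hs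
              -- A path in `S′` from `x₀` avoids `r`, so it stays in the component `H` of `x₀`.
              (λ x∈S′ → component-closed (All.lookup (AreComponents.components comps) H∈Hs)
                          x₀∈H (Path-mono S′⊆S-r (reach x∈S′)))
              conn
        in r′ , r′∈S′ , λ x∈S′ → ℕ.m≤n⇒m≤o+n _ (above x∈S′)

    common-ancestorᶠ : Pointwise (IsSearchTreeOn G) Hs ts → H ∈ₗ Hs → S′ ⊆ H →
      RootedConnected S′ →
      ∃ λ r → r ∈ S′ × (∀ {x} → x ∈ S′ → 1 ≤ ancestorsᶠ (𝟙 ⁅ r ⁆) ts x)
    common-ancestorᶠ (tree ∷ _) (here refl) S′⊆H conn =
      let r , r∈S′ , above = common-ancestor tree S′⊆H conn
      in r , r∈S′ , λ x∈S′ → ℕ.m≤n⇒m≤n+o _ (above x∈S′)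
    common-ancestorᶠ (_ ∷ trees) (there H∈Hs) S′⊆H conn =
      let r , r∈S′ , above = common-ancestorᶠ trees H∈Hs S′⊆H conn
      in r , r∈S′ , λ x∈S′ → ℕ.m≤n⇒m≤o+n _ (above x∈S′)

-- Ancestors lost on passing from a set to its components

module _ {n : ℕ} (G : Graph n) {T : RootedTree n} (searchT : IsSearchTree G T) where

  -- K S x is the depth of x ∈ S in the search tree that T induces on a connected S,
  -- whose ancestor relation is that of T restricted to S.
  K : Subset n → Fin n → ℕ
  K S x = 𝟙 S x * ancestors (𝟙 S) T x

  ΣK : List (Subset n) → Fin n → ℕ
  ΣK Hs x = sum (map (λ H → K H x) Hs)

  K-∈ : ∀ {S x} → x ∈ S → K S x ≡ ancestors (𝟙 S) T x
  K-∈ {S} {x} x∈S = trans (cong (_* ancestors (𝟙 S) T x) (𝟙-∈ x∈S)) (ℕ.*-identityˡ _)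

  K-∉ : ∀ {S x} → x ∉ S → K S x ≡ 0
  K-∉ {S} {x} x∉S = cong (_* ancestors (𝟙 S) T x) (𝟙-∉ x∉S)

  K⊤≤depth : ∀ x → K ⊤ x ≤ depth 1 T x
  K⊤≤depth x = begin
    K ⊤ x                     ≡⟨ K-∈ ∈⊤ ⟩
    ancestors (𝟙 ⊤) T x       ≤⟨ ancestors-mono (λ y → ℕ.≤-reflexive (𝟙-∈ {x = y} ∈⊤)) T x ⟩
    ancestors (const 1) T x   ≡⟨ ancestors-1 T x ⟩
    depth 1 T x               ∎
    where open ℕ.≤-Reasoning

  -- This is how a lost ancestor is recorded: with `U` a singleton outside `S`, each vertex below it
  -- has at least one more ancestor in `R` than in `S`.
  ancestors-disjoint-+ : ∀ {S U R} → S ⊆ R → U ⊆ R → (∀ {x} → x ∈ S → x ∉ U) → ∀ x →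
    ancestors (𝟙 S) T x + ancestors (𝟙 U) T x ≤ ancestors (𝟙 R) T x
  ancestors-disjoint-+ {S} {U} {R} S⊆R U⊆R S#U x = begin
    ancestors (𝟙 S) T x + ancestors (𝟙 U) T x  ≡⟨ ancestors-+ (𝟙 S) (𝟙 U) T x ⟨
    ancestors (λ y → 𝟙 S y + 𝟙 U y) T x        ≤⟨ ancestors-mono (𝟙-disjoint-+ S⊆R U⊆R S#U) T x ⟩
    ancestors (𝟙 R) T x                        ∎
    where open ℕ.≤-Reasoning

  ancestors-⊆ : ∀ {H S} → H ⊆ S → ∀ x → ancestors (𝟙 H) T x ≤ ancestors (𝟙 S) T x
  ancestors-⊆ H⊆S = ancestors-mono (𝟙-mono H⊆S) T

  1≤ancestors-self : ∀ x → 1 ≤ ancestors (𝟙 ⁅ x ⁆) T x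
  1≤ancestors-self x = ℕ.≤-trans
    (ℕ.≤-reflexive (sym (trans (multiplicity≡𝟙 G searchT x) (𝟙-∈ {x = x} ∈⊤))))
    (multiplicity≤ancestors T x)

  module _ {S : Subset n} {c : Fin n} {Hs : List (Subset n)}
           (c∈S : c ∈ S) (comps : AreComponents G (S - c) Hs)
           {r : Fin n} (r∈S : r ∈ S) (above : ∀ {x} → x ∈ S → 1 ≤ ancestors (𝟙 ⁅ r ⁆) T x) where

    open AreComponents comps
    open ℕ.≤-Reasoning

    data Location (x : Fin n) : Set where
      outside : x ∉ S → Location x
      centre  : x ≡ c → Location x
      within  : ∀ {H} → H ∈ₗ Hs → x ∈ H → Location x

    locate : ∀ x → Location x
    locate x with x ∈? S | x Fin.≟ c
    ... | no x∉S  | _       = outside x∉S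
    ... | yes _   | yes x≡c = centre x≡c
    ... | yes x∈S | no x≢c  with component-of G comps (x∈p∧x≢y⇒x∈p-y x∈S x≢c)
    ...   | _ , H∈Hs , x∈H = within H∈Hs x∈H

    H⊆S-c : ∀ {H} → H ∈ₗ Hs → H ⊆ S - c
    H⊆S-c H∈Hs = component-⊆ G (All.lookup components H∈Hs)

    H⊆S : ∀ {H} → H ∈ₗ Hs → H ⊆ S
    H⊆S H∈Hs = p─q⊆p S ⁅ c ⁆ ∘ H⊆S-c H∈Hs

    c∉H : ∀ {H} → H ∈ₗ Hs → c ∉ H
    c∉H H∈Hs c∈H = x∉p-x S c (H⊆S-c H∈Hs c∈H)

    x∉⁅c⁆ : ∀ {x H} → H ∈ₗ Hs → x ∈ H → x ∉ ⁅ c ⁆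
    x∉⁅c⁆ {H = H} H∈Hs x∈H x∈⁅c⁆ = c∉H H∈Hs (subst (_∈ H) (x∈⁅y⁆⇒x≡y c x∈⁅c⁆) x∈H)

    ΣK-∉ : ∀ {x} → x ∉ S - c → ΣK Hs x ≡ 0
    ΣK-∉ {x} = sum-components-∉ G comps (λ H → K H x) K-∉

    ΣK-∈ : ∀ {x H} → H ∈ₗ Hs → x ∈ H → ΣK Hs x ≡ ancestors (𝟙 H) T x
    ΣK-∈ {x} H∈Hs x∈H = trans (sum-components-∈ G comps (λ H → K H x) K-∉ H∈Hs x∈H) (K-∈ x∈H)

    -- Within a component H that misses r, every vertex loses the ancestor r.
    K-gain : ∀ {x H} → H ∈ₗ Hs → x ∈ H → r ∉ H → ΣK Hs x + 𝟙 S x ≤ K S x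
    K-gain {x} {H} H∈Hs x∈H r∉H = begin
      ΣK Hs x + 𝟙 S x                                ≡⟨ cong₂ _+_ (ΣK-∈ H∈Hs x∈H) (𝟙-∈ x∈S) ⟩
      ancestors (𝟙 H) T x + 1                        ≤⟨ ℕ.+-monoʳ-≤ _ (above x∈S) ⟩
      ancestors (𝟙 H) T x + ancestors (𝟙 ⁅ r ⁆) T x  ≤⟨ ancestors-disjoint-+ (H⊆S H∈Hs) (⁅⁆⊆ r∈S)
                                                          (λ y∈H y∈⁅r⁆ → r∉H (subst (_∈ H) (x∈⁅y⁆⇒x≡y r y∈⁅r⁆) y∈H)) x ⟩
      ancestors (𝟙 S) T x                            ≡⟨ K-∈ x∈S ⟨
      K S x                                          ∎
      where
      x∈S : x ∈ S
      x∈S = H⊆S H∈Hs x∈H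

    -- No component contains `c`, so `K-gain` applies to each of them; `c` itself is missing from
    -- `ΣK` but is its own ancestor in `K S`.
    K-top≡centre : r ≡ c → ∀ x → ΣK Hs x + 𝟙 S x ≤ K S x
    K-top≡centre refl x with locate x
    ... | within H∈Hs x∈H = K-gain H∈Hs x∈H (c∉H H∈Hs)
    ... | outside x∉S = begin
      ΣK Hs x + 𝟙 S x  ≡⟨ cong₂ _+_ (ΣK-∉ (x∉S ∘ p─q⊆p S ⁅ c ⁆)) (𝟙-∉ x∉S) ⟩
      0                ≤⟨ z≤n ⟩
      K S x            ∎
    ... | centre refl = begin
      ΣK Hs c + 𝟙 S c            ≡⟨ cong₂ _+_ (ΣK-∉ (x∉p-x S c)) (𝟙-∈ c∈S) ⟩
      1                          ≤⟨ 1≤ancestors-self c ⟩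
      ancestors (𝟙 ⁅ c ⁆) T c    ≤⟨ ancestors-⊆ (⁅⁆⊆ c∈S) c ⟩
      ancestors (𝟙 S) T c        ≡⟨ K-∈ c∈S ⟨
      K S c                      ∎

    -- Losses are moved across to avoid subtraction: `𝟙 H₀` on the right exempts the vertices of
    -- `H₀`, which may keep the ancestor `r`, and `𝟙 ⁅ c ⁆` on the left records the second unit lost
    -- at `c`.
    K-top∈component : ∀ {H₀} → H₀ ∈ₗ Hs → r ∈ H₀ →
      ∀ x → (ΣK Hs x + 𝟙 S x) + 𝟙 ⁅ c ⁆ x ≤ K S x + 𝟙 H₀ x
    K-top∈component {H₀} H₀∈Hs r∈H₀ x with locate x
    ... | outside x∉S = begin
      (ΣK Hs x + 𝟙 S x) + 𝟙 ⁅ c ⁆ x  ≡⟨ cong₂ _+_ (cong₂ _+_ (ΣK-∉ (x∉S ∘ p─q⊆p S ⁅ c ⁆)) (𝟙-∉ x∉S))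
                                                  (𝟙-∉ (x∉S ∘ ⁅⁆⊆ c∈S)) ⟩
      0                              ≤⟨ z≤n ⟩
      K S x + 𝟙 H₀ x                 ∎
    ... | centre refl = begin
      (ΣK Hs c + 𝟙 S c) + 𝟙 ⁅ c ⁆ c                      ≡⟨ cong₂ _+_ (cong₂ _+_ (ΣK-∉ (x∉p-x S c)) (𝟙-∈ c∈S))
                                                                      (𝟙-∈ (x∈⁅x⁆ c)) ⟩
      -- The two units are the ancestors `c` and `r` of `c`, distinct because `r` lies in `H₀` and
      -- `c` does not.
      1 + 1                                              ≤⟨ ℕ.+-mono-≤ (1≤ancestors-self c) (above c∈S) ⟩
      ancestors (𝟙 ⁅ c ⁆) T c + ancestors (𝟙 ⁅ r ⁆) T c  ≤⟨ ancestors-disjoint-+ (⁅⁆⊆ c∈S) (⁅⁆⊆ r∈S)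
                                                              (λ y∈⁅c⁆ y∈⁅r⁆ → c∉H H₀∈Hs (subst (_∈ H₀)
                                                                (trans (sym (x∈⁅y⁆⇒x≡y r y∈⁅r⁆)) (x∈⁅y⁆⇒x≡y c y∈⁅c⁆)) r∈H₀)) c ⟩
      ancestors (𝟙 S) T c                                ≡⟨ K-∈ c∈S ⟨
      K S c                                              ≤⟨ ℕ.m≤m+n (K S c) (𝟙 H₀ c) ⟩
      K S c + 𝟙 H₀ c                                     ∎
    ... | within {H} H∈Hs x∈H with x ∈? H₀
    ...   | no x∉H₀ = begin
      (ΣK Hs x + 𝟙 S x) + 𝟙 ⁅ c ⁆ x  ≡⟨ cong (ΣK Hs x + 𝟙 S x +_) (𝟙-∉ (x∉⁅c⁆ H∈Hs x∈H)) ⟩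
      (ΣK Hs x + 𝟙 S x) + 0          ≤⟨ ℕ.+-monoˡ-≤ 0 (K-gain H∈Hs x∈H r∉H) ⟩
      K S x + 0                      ∎
      where
      r∉H : r ∉ H
      r∉H r∈H = x∉H₀ (subst (x ∈_)
        (component-unique G (All.lookup components H∈Hs) (All.lookup components H₀∈Hs) r∈H r∈H₀) x∈H)
    -- Inside `H₀` monotonicity is enough, as `𝟙 H₀` pays for the unit `𝟙 S x`.
    ...   | yes x∈H₀ = begin
      (ΣK Hs x + 𝟙 S x) + 𝟙 ⁅ c ⁆ x    ≡⟨ cong₂ _+_ (cong₂ _+_ (ΣK-∈ H∈Hs x∈H) (𝟙-∈ (H⊆S H∈Hs x∈H)))
                                                    (𝟙-∉ (x∉⁅c⁆ H∈Hs x∈H)) ⟩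
      (ancestors (𝟙 H) T x + 1) + 0    ≡⟨ ℕ.+-identityʳ _ ⟩
      ancestors (𝟙 H) T x + 1          ≤⟨ ℕ.+-monoˡ-≤ 1 (ancestors-⊆ (H⊆S H∈Hs) x) ⟩
      ancestors (𝟙 S) T x + 1          ≡⟨ cong (_+ 1) (K-∈ (H⊆S H∈Hs x∈H)) ⟨
      K S x + 1                        ∎

  -- Weighted induction over the centroid tree

  module _ (w : Fin n → ℝ) (0≤w : ∀ x → 0ℝ ≤ℝ w x) where

    open Weighted w

    -- Doubling the centroid inequality clears the factor ½ and keeps all coefficients natural.
    half-weight : ∀ {S H} → weight w H ≤ℝ ½ · weight w S → (λ x → 𝟙 H x + 𝟙 H x) ≼ 𝟙 S
    half-weight {S} {H} H≤½S .sums = resp-≲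
      (λ j → trans (L-+ (𝟙 H) (𝟙 H) j) (cong₂ ℚ._+_ (sym (seq-weight H j)) (sym (seq-weight H j))))
      (λ j → trans (sym (seq-weight S j)) (halves (seq (weight w S) j)))
      (+-mono-≲ H≲½S H≲½S)
      where
      H≲½S : seq (weight w H) ≲ seq (½ · weight w S)
      H≲½S = eventually H≤½S

      halves : ∀ q → q ≡ ½ ℚ.* q ℚ.+ ½ ℚ.* q
      halves q = trans (sym (ℚ.*-identityˡ q)) (ℚ.*-distribʳ-+ q ½ ½)

    module _ {S : Subset n} {c : Fin n} {Hs : List (Subset n)}
             (c∈S : c ∈ S) (comps : AreComponents G (S - c) Hs)
             (half : ∀ {H} → H ∈ₗ Hs → (λ x → 𝟙 H x + 𝟙 H x) ≼ 𝟙 S)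
             (connected : RootedConnected G S) where

      -- The inductive step: the left side is `depth 2` of the tree with root `c`, after its child
      -- subtrees have been replaced by their bound `ΣK Hs x + ΣK Hs x`.
      ΣK≼K : (λ x → 𝟙 ⁅ c ⁆ x + (ΣK Hs x + ΣK Hs x) + 𝟙 S x) ≼ (λ x → K S x + K S x)
      ΣK≼K with common-ancestor G searchT (λ _ → ∈⊤) connected
      ... | r , r∈S , above with r Fin.≟ c
      -- The doubled gain is two copies of `𝟙 S`: one is the summand `𝟙 S` itself, the other covers
      -- `𝟙 ⁅ c ⁆`.
      ...   | yes r≡c = ≤⇒≼ 0≤w λ x → begin
        𝟙 ⁅ c ⁆ x + (ΣK Hs x + ΣK Hs x) + 𝟙 S x  ≤⟨ ℕ.+-monoˡ-≤ (𝟙 S x) (ℕ.+-monoˡ-≤ (ΣK Hs x + ΣK Hs x)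
                                                      (𝟙-mono (⁅⁆⊆ c∈S) x)) ⟩
        𝟙 S x + (ΣK Hs x + ΣK Hs x) + 𝟙 S x      ≡⟨ rearrange (𝟙 S x) (ΣK Hs x) ⟩
        (ΣK Hs x + 𝟙 S x) + (ΣK Hs x + 𝟙 S x)    ≤⟨ ℕ.+-mono-≤ (gain x) (gain x) ⟩
        K S x + K S x                            ∎
        where
        open ℕ.≤-Reasoning
        gain : ∀ x → ΣK Hs x + 𝟙 S x ≤ K S x
        gain = K-top≡centre c∈S comps r∈S above r≡c
        rearrange : ∀ i k → i + (k + k) + i ≡ (k + i) + (k + i)
        rearrange = solve 2 (λ i k → i :+ (k :+ k) :+ i := (k :+ i) :+ (k :+ i)) refl
          where open +-*-Solver
      ...   | no r≢c with component-of G comps (x∈p∧x≢y⇒x∈p-y r∈S r≢c)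
      -- The doubled gain leaves `𝟙 H₀ x + 𝟙 H₀ x` on the right. The centroid property bounds it by
      -- `𝟙 S`, which cancels the second copy of `𝟙 S` on the left.
      ...     | H₀ , H₀∈Hs , r∈H₀ = cancel-≼ (𝟙 S) (≼-trans
        (≤⇒≼ 0≤w λ x → begin
          (𝟙 ⁅ c ⁆ x + (ΣK Hs x + ΣK Hs x) + 𝟙 S x) + 𝟙 S x
            ≤⟨ ℕ.m≤m+n _ (𝟙 ⁅ c ⁆ x) ⟩
          (𝟙 ⁅ c ⁆ x + (ΣK Hs x + ΣK Hs x) + 𝟙 S x) + 𝟙 S x + 𝟙 ⁅ c ⁆ x
            ≡⟨ rearrange (𝟙 ⁅ c ⁆ x) (𝟙 S x) (ΣK Hs x) ⟩
          (ΣK Hs x + 𝟙 S x + 𝟙 ⁅ c ⁆ x) + (ΣK Hs x + 𝟙 S x + 𝟙 ⁅ c ⁆ x)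
            ≤⟨ ℕ.+-mono-≤ (gain x) (gain x) ⟩
          (K S x + 𝟙 H₀ x) + (K S x + 𝟙 H₀ x)
            ≡⟨ interchange (K S x) (𝟙 H₀ x) (K S x) (𝟙 H₀ x) ⟩
          (K S x + K S x) + (𝟙 H₀ x + 𝟙 H₀ x) ∎)
        (+-mono-≼ (≼-refl (λ x → K S x + K S x)) (half H₀∈Hs)))
        where
        open ℕ.≤-Reasoning
        gain : ∀ x → (ΣK Hs x + 𝟙 S x) + 𝟙 ⁅ c ⁆ x ≤ K S x + 𝟙 H₀ x
        gain = K-top∈component c∈S comps r∈S above H₀∈Hs r∈H₀
        rearrange : ∀ j i k → j + (k + k) + i + i + j ≡ (k + i + j) + (k + i + j)
        rearrange = solve 3 (λ j i k → j :+ (k :+ k) :+ i :+ i :+ j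
                                       := (k :+ i :+ j) :+ (k :+ i :+ j)) refl
          where open +-*-Solver

    -- depth 2 C adds up to the cost of C plus the weight of S.
    mutual
      depth≼K : ∀ {S C} → IsSearchTreeOn G S C → RootedConnected G S →
        (∀ {U} → U ⊑ C → IsCentroid G w (V U) (root U)) →
        depth 2 C ≼ (λ x → K S x + K S x)
      depth≼K {S} tree@(node {Hs = Hs} {c} {ts} c∈S comps trees) connected centroid =
        -- Splitting off one level as `𝟙 S` lets the children start at depth 2 instead of 3, which
        -- is the form of the induction hypothesis.
        ≼-trans (≤⇒≼ 0≤w λ x → ℕ.≤-reflexive (depth-2 x))
          (≼-trans
            (+-mono-≼ (+-mono-≼ (≼-refl (𝟙 ⁅ c ⁆))
              (depthᶠ≼ΣK trees (All.map (component-connected G) components)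
                λ t∈ts U⊑t → centroid (below U⊑t t∈ts)))
              (≼-refl (𝟙 S)))
            (ΣK≼K c∈S comps half connected))
        where
        open AreComponents comps

        depth-2 : ∀ x → depth 2 (node c ts) x ≡ 𝟙 ⁅ c ⁆ x + depthᶠ 2 ts x + 𝟙 S x
        depth-2 x = trans (depth-suc 1 (node c ts) x) (cong₂ _+_
          (cong (_+ depthᶠ 2 ts x) (ℕ.*-identityˡ (𝟙 ⁅ c ⁆ x))) (multiplicity≡𝟙 G tree x))

        half : ∀ {H} → H ∈ₗ Hs → (λ x → 𝟙 H x + 𝟙 H x) ≼ 𝟙 S
        half {H} H∈Hs = half-weight (proj₂
          (subst (λ R → IsCentroid G w R c) (V≡ G tree) (centroid here))
          H (All.lookup components H∈Hs))

      depthᶠ≼ΣK : ∀ {Hs ts} → Pointwise (IsSearchTreeOn G) Hs ts → All (RootedConnected G) Hs →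
        (∀ {t U} → t ∈ₗ ts → U ⊑ t → IsCentroid G w (V U) (root U)) →
        depthᶠ 2 ts ≼ (λ x → ΣK Hs x + ΣK Hs x)
      depthᶠ≼ΣK [] [] _ = ≤⇒≼ 0≤w λ _ → z≤n
      depthᶠ≼ΣK {H ∷ Hs} (tree ∷ trees) (connected ∷ connecteds) centroid = ≼-trans
        (+-mono-≼ (depth≼K tree connected (centroid (here refl)))
                  (depthᶠ≼ΣK trees connecteds (centroid ∘ there)))
        (≤⇒≼ 0≤w λ x → ℕ.≤-reflexive (interchange (K H x) (K H x) (ΣK Hs x) (ΣK Hs x)))

-- Comparison of the centroid tree with an optimal tree

tree-connected : ∀ {n} {G : Graph n} → IsTree G → RootedConnected G ⊤
tree-connected {suc n} isTree =
  zero , ∈⊤ , λ {y} _ → Star.map (λ x~y → ∈⊤ , ∈⊤ , x~y) (IsTree.connected isTree zero y)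
tree-connected {zero}  isTree with () ← IsTree.nonempty isTree

theorem1 : ∀ {n : ℕ} (𝒯 : Graph n) → IsTree 𝒯 →
    (w : Fin n → ℝ) → (∀ x → 0ℝ ≤ℝ w x) →
    ∀ (opt cent : ℝ) → IsOPT 𝒯 w opt → IsCent 𝒯 w cent →
    cent ≤ℝ ℕ→ℚ 2 · opt -ℝ weight w ⊤
theorem1 𝒯 isTree w 0≤w opt cent
  ((T , searchT , costT≃opt) , _) ((C , (searchC , centroid) , costC≃cent) , _) = bound
    -- The weight is subtracted from both sides of `cent+m≲2opt`.
    (shift-≲ (λ j → ℚ.- seq (weight w ⊤) j)
      (λ j → p≡p+q-q (seq cent j) (seq (weight w ⊤) j))
      (λ j → double-minus (seq opt j) (seq (weight w ⊤) j))
      cent+m≲2opt)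
  where
  open Weighted w

  -- The induction at `S = ⊤`, with `K ⊤` bounded by the depth in `T`.
  depths≼ : (λ x → depth 1 C x + 𝟙 ⊤ x) ≼ (λ x → depth 1 T x + depth 1 T x)
  depths≼ = ≼-trans
    (≤⇒≼ 0≤w λ x → ℕ.≤-reflexive (sym (trans (depth-suc 1 C x)
      (cong (depth 1 C x +_) (multiplicity≡𝟙 𝒯 searchC x)))))
    (≼-trans
      (depth≼K 𝒯 searchT w 0≤w searchC (tree-connected isTree) centroid)
      (≤⇒≼ 0≤w λ x → ℕ.+-mono-≤ (K⊤≤depth 𝒯 searchT x) (K⊤≤depth 𝒯 searchT x)))

  costs≲ : (λ j → seq (cost w C) j ℚ.+ seq (weight w ⊤) j) ≲
           (λ j → seq (cost w T) j ℚ.+ seq (cost w T) j)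
  costs≲ = resp-≲
    (λ j → trans (cong₂ ℚ._+_ (seq-cost w C j) (seq-weight ⊤ j)) (sym (L-+ (depth 1 C) (𝟙 ⊤) j)))
    (λ j → trans (cong₂ ℚ._+_ (seq-cost w T j) (seq-cost w T j))
                 (sym (L-+ (depth 1 T) (depth 1 T) j)))
    (sums depths≼)

  cent+m≲2opt : (λ j → seq cent j ℚ.+ seq (weight w ⊤) j) ≲ (λ j → seq opt j ℚ.+ seq opt j)
  cent+m≲2opt = ≲-trans
    (+-mono-≲ (≃⇒≲ {cent} {cost w C} (≃-sym {cost w C} {cent} costC≃cent)) ≲-refl)
    (≲-trans costs≲ (+-mono-≲ costT≲opt costT≲opt))
    where
    costT≲opt : seq (cost w T) ≲ seq opt
    costT≲opt = ≃⇒≲ {cost w T} {opt} costT≃opt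

  double-minus : ∀ p q → ℕ→ℚ 2 ℚ.* p ℚ.+ (ℚ.- 1ℚ) ℚ.* q ≡ (p ℚ.+ p) ℚ.+ ℚ.- q
  double-minus = solve 2 (λ p q → con (ℕ→ℚ 2) :* p :+ (:- con 1ℚ) :* q := (p :+ p) :+ :- q) refl
    where open ℚ.+-*-Solver
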